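{- Let $(\mathbf{ctx},u,\dot u,\Sigma\dashv\Delta)$ be a plain dependent type theory with extensional $\Phi$-types given by functors $\Phi:\mathcal Y\to\mathcal U$, $\Psi:\mathcal X\to\dot{\mathcal U}$, $\Lambda:\mathcal X\to\mathcal Y$. Then the usual formation, introduction, elimination, $\beta$- and $\eta$-computation rules hold: (F) if $\Gamma\vdash Y\ \mathcal Y$ (an object $Y\in\mathcal Y$ over $\Gamma$), then $\Phi Y$ is a type over $\Gamma$; (I) if $\Gamma\vdash X\ \mathcal X$, then $\Psi X$ is a term over $\Gamma$ of type $\Phi\Lambda X$; (E) there is a functor $(-)\langle-\rangle:\mathcal Y\Sigma.\Phi\dot{\mathcal U}\to\mathcal X$ over $\mathbf{ctx}$ sending a pair $(Y,a)$ with $\Sigma a=\Phi Y$ to $Y\langle a\rangle$, and it is inverse to the functor $\Lambda\star\Psi:\mathcal X\to\mathcal Y\Sigma.\Phi\dot{\mathcal U}$, $X\mapsto(\Lambda X,\Psi X)$; ($\beta$) for every $X\in\mathcal X$, $\Psi X=\Psi\big((\Lambda X)\langle\Psi X\rangle\big)$; ($\eta$) for every $(Y,a)$ with $\Sigma a=\Phi Y$, $a=\Psi(Y\langle a\rangle)$.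
   Context: Plain dependent type theory (pDTT): a category $\mathbf{ctx}$ (with terminal object), fibrations $u:\mathcal U\to\mathbf{ctx}$ (types) and $\dot u:\dot{\mathcal U}\to\mathbf{ctx}$ (terms), a functor $\Sigma:\dot{\mathcal U}\to\mathcal U$ (typing) with $u\Sigma=\dot u$, and a right adjoint $\Delta:\mathcal U\to\dot{\mathcal U}$ of $\Sigma$ (not required to commute with the projections to $\mathbf{ctx}$), with unit and counit having cartesian components and $\Sigma,\Delta$ preserving cartesian morphisms. An object $A$ with $u(A)=\Gamma$ is a type over $\Gamma$; an object $a$ with $\dot u(a)=\Gamma$ and $\Sigma a=A$ is a term over $\Gamma$ of type $A$. Extensional $\Phi$-types: categories $\mathcal X,\mathcal Y$ and functors $\Lambda:\mathcal X\to\mathcal Y$ and $\mathcal Y\to\mathbf{ctx}$ (obtained by finite limits from the generating data), together with functors $\Phi:\mathcal Y\to\mathcal U$ over $\mathbf{ctx}$ and $\Psi:\mathcal X\to\dot{\mathcal U}$ such that $\Sigma\Psi=\Phi\Lambda$ and this square is a pullback of categories. $\mathcal X$ lies over $\mathbf{ctx}$ via $\Lambda$. $\mathcal Y\Sigma.\Phi\dot{\mathcal U}$ denotes the canonical pullback of $\Phi$ and $\Sigma$, with objects the pairs $(Y,a)$ such that $\Phi Y=\Sigma a$. -}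

module Defs where

open import Level using (Level; _⊔_) renaming (suc to lsuc)
open import Data.Product using (_×_; ∃-syntax)
open import Relation.Binary.PropositionalEquality
  using (_≡_; refl; sym; trans; cong; cong₂; subst₂)

private
  variable
    o ℓ : Level

-- Categories are strict: objects and morphisms are compared with _≡_, and this
-- file uses axiom K, so equality of objects is a mere property.
record Category (o ℓ : Level) : Set (lsuc (o ⊔ ℓ)) where
  infixr 9 _∘_
  field
    Obj   : Set o
    Hom   : Obj → Obj → Set ℓ
    id    : ∀ {A} → Hom A A
    _∘_   : ∀ {A B C} → Hom B C → Hom A B → Hom A C
    idˡ   : ∀ {A B} (f : Hom A B) → id ∘ f ≡ f
    idʳ   : ∀ {A B} (f : Hom A B) → f ∘ id ≡ f
    assoc : ∀ {A B C D} (h : Hom C D) (g : Hom B C) (f : Hom A B) →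
            (h ∘ g) ∘ f ≡ h ∘ (g ∘ f)

  transport : ∀ {A A′ B B′} → A ≡ A′ → B ≡ B′ → Hom A B → Hom A′ B′
  transport = subst₂ Hom

open Category using (Obj; Hom; transport)

record IsTerminal (C : Category o ℓ) (t : Obj C) : Set (o ⊔ ℓ) where
  field
    !        : ∀ A → Hom C A t
    !-unique : ∀ {A} (f : Hom C A t) → f ≡ ! A

record Functor (C D : Category o ℓ) : Set (o ⊔ ℓ) where
  private
    module C = Category C
    module D = Category D
  field
    F₀   : Obj C → Obj D
    F₁   : ∀ {A B} → Hom C A B → Hom D (F₀ A) (F₀ B)
    F-id : ∀ {A} → F₁ (C.id {A}) ≡ D.id
    F-∘  : ∀ {A B E} (g : Hom C B E) (f : Hom C A B) →
           F₁ (g C.∘ f) ≡ F₁ g D.∘ F₁ f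

open Functor public using (F₀; F₁; F-id; F-∘)

idF : {C : Category o ℓ} → Functor C C
idF = record { F₀ = λ A → A ; F₁ = λ f → f ; F-id = refl ; F-∘ = λ _ _ → refl }

infixr 9 _∘F_
_∘F_ : {C D E : Category o ℓ} → Functor D E → Functor C D → Functor C E
G ∘F F = record
  { F₀   = λ A → F₀ G (F₀ F A)
  ; F₁   = λ f → F₁ G (F₁ F f)
  ; F-id = trans (cong (F₁ G) (F-id F)) (F-id G)
  ; F-∘  = λ g f → trans (cong (F₁ G) (F-∘ F g f)) (F-∘ G (F₁ F g) (F₁ F f))
  }

-- Equality of functors in extensional form (in the absence of function
-- extensionality): equal on objects and, modulo that, equal on morphisms.
infix 4 _≈F_
record _≈F_ {C D : Category o ℓ} (F G : Functor C D) : Set (o ⊔ ℓ) where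
  field
    eq₀ : ∀ A → F₀ F A ≡ F₀ G A
    eq₁ : ∀ {A B} (f : Hom C A B) →
          transport D (eq₀ A) (eq₀ B) (F₁ F f) ≡ F₁ G f

record NatTrans {C D : Category o ℓ} (F G : Functor C D) : Set (o ⊔ ℓ) where
  private module D = Category D
  field
    component : ∀ A → Hom D (F₀ F A) (F₀ G A)
    natural   : ∀ {A B} (f : Hom C A B) →
                component B D.∘ F₁ F f ≡ F₁ G f D.∘ component A

record Adjunction {C D : Category o ℓ} (L : Functor C D) (R : Functor D C)
                  : Set (o ⊔ ℓ) where
  private
    module C = Category C
    module D = Category D
  field
    unit   : NatTrans idF (R ∘F L)
    counit : NatTrans (L ∘F R) idF

  open NatTrans unit   public using () renaming (component to η)
  open NatTrans counit public using () renaming (component to ε)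

  field
    zig : ∀ A → ε (F₀ L A) D.∘ F₁ L (η A) ≡ D.id
    zag : ∀ B → F₁ R (ε B) C.∘ η (F₀ R B) ≡ C.id

module _ {E B : Category o ℓ} (p : Functor E B) where
  private
    module E = Category E
    module B = Category B

  IsCartesian : {X Y : Obj E} → Hom E X Y → Set (o ⊔ ℓ)
  IsCartesian {X} φ =
    ∀ {Z} (g : Hom E Z _) (h : Hom B (F₀ p Z) (F₀ p X)) →
    F₁ p φ B.∘ h ≡ F₁ p g →
    ∃[ k ] (F₁ p k ≡ h × φ E.∘ k ≡ g) ×
           (∀ k′ → F₁ p k′ ≡ h → φ E.∘ k′ ≡ g → k′ ≡ k)

  record CartesianLift {I : Obj B} {Y : Obj E} (f : Hom B I (F₀ p Y))
                       : Set (o ⊔ ℓ) where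
    field
      source      : Obj E
      lift        : Hom E source Y
      source-over : F₀ p source ≡ I
      lift-over   : transport B source-over refl (F₁ p lift) ≡ f
      cartesian   : IsCartesian lift

  IsFibration : Set (o ⊔ ℓ)
  IsFibration = ∀ {I Y} (f : Hom B I (F₀ p Y)) → CartesianLift f

PreservesCartesian : {E E′ B : Category o ℓ} (p : Functor E B) (p′ : Functor E′ B) →
                     Functor E E′ → Set (o ⊔ ℓ)
PreservesCartesian {E = E} p p′ F =
  ∀ {X Y} (φ : Hom E X Y) → IsCartesian p φ → IsCartesian p′ (F₁ F φ)

record IsTerminalCategory (T : Category o ℓ) : Set (lsuc (o ⊔ ℓ)) where
  field
    !        : ∀ Z → Functor Z T
    !-unique : ∀ {Z} (H : Functor Z T) → H ≈F ! Z

-- The commutative square F ∘ p = G ∘ q is a (strict) pullback of categories.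
record IsPullback {P A B C : Category o ℓ}
                  (F : Functor A C) (G : Functor B C)
                  (p : Functor P A) (q : Functor P B) : Set (lsuc (o ⊔ ℓ)) where
  field
    commutes : F ∘F p ≈F G ∘F q
    mediate  : ∀ {Z} (h : Functor Z A) (k : Functor Z B) → F ∘F h ≈F G ∘F k →
               Functor Z P
    mediate₁ : ∀ {Z} (h : Functor Z A) (k : Functor Z B) (e : F ∘F h ≈F G ∘F k) →
               p ∘F mediate h k e ≈F h
    mediate₂ : ∀ {Z} (h : Functor Z A) (k : Functor Z B) (e : F ∘F h ≈F G ∘F k) →
               q ∘F mediate h k e ≈F k
    unique   : ∀ {Z} (h : Functor Z A) (k : Functor Z B) (e : F ∘F h ≈F G ∘F k)
               (m : Functor Z P) → p ∘F m ≈F h → q ∘F m ≈F k →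
               m ≈F mediate h k e

module _ (C : Category o ℓ) where
  private module C = Category C

  transport-id : ∀ {A A′} (e : A ≡ A′) → transport C e e C.id ≡ C.id
  transport-id refl = refl

  transport-∘ : ∀ {A A′ B B′ D D′} (a : A ≡ A′) (b : B ≡ B′) (d : D ≡ D′)
                (g : Hom C B D) (f : Hom C A B) →
                transport C a d (g C.∘ f) ≡ transport C b d g C.∘ transport C a b f
  transport-∘ refl refl refl g f = refl

module _ {A B C : Category o ℓ} (F : Functor A C) (G : Functor B C) where
  private
    module A = Category A
    module B = Category B
    module C = Category C

  record PullbackObj : Set o where
    constructor ⟨_,_⟩[_]
    field
      fst  : Obj A
      snd  : Obj B
      over : F₀ F fst ≡ F₀ G snd

  open PullbackObj

  record PullbackHom (X Y : PullbackObj) : Set ℓ where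
    constructor ⟪_,_⟫[_]
    field
      fst₁  : Hom A (fst X) (fst Y)
      snd₁  : Hom B (snd X) (snd Y)
      over₁ : transport C (over X) (over Y) (F₁ F fst₁) ≡ F₁ G snd₁

  open PullbackHom

  private
    uip : ∀ {a} {S : Set a} {v w : S} (r s : v ≡ w) → r ≡ s
    uip refl refl = refl

    PullbackHom-≡ : ∀ {X Y} {f g : PullbackHom X Y} →
                    fst₁ f ≡ fst₁ g → snd₁ f ≡ snd₁ g → f ≡ g
    PullbackHom-≡ {f = ⟪ _ , _ ⟫[ r ]} {⟪ _ , _ ⟫[ s ]} refl refl =
      cong ⟪ _ , _ ⟫[_] (uip r s)

  Pullback : Category o ℓ
  Pullback = record
    { Obj   = PullbackObj
    ; Hom   = PullbackHom
    ; id    = λ {X} → ⟪ A.id , B.id ⟫[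
        trans (cong (transport C (over X) (over X)) (F-id F))
              (trans (transport-id C (over X)) (sym (F-id G))) ]
    ; _∘_   = λ {X} {Y} {Z} g f → ⟪ fst₁ g A.∘ fst₁ f , snd₁ g B.∘ snd₁ f ⟫[
        trans (cong (transport C (over X) (over Z)) (F-∘ F (fst₁ g) (fst₁ f)))
        (trans (transport-∘ C (over X) (over Y) (over Z) (F₁ F (fst₁ g)) (F₁ F (fst₁ f)))
        (trans (cong₂ C._∘_ (over₁ g) (over₁ f))
               (sym (F-∘ G (snd₁ g) (snd₁ f))))) ]
    ; idˡ   = λ f → PullbackHom-≡ (A.idˡ (fst₁ f)) (B.idˡ (snd₁ f))
    ; idʳ   = λ f → PullbackHom-≡ (A.idʳ (fst₁ f)) (B.idʳ (snd₁ f))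
    ; assoc = λ h g f → PullbackHom-≡ (A.assoc (fst₁ h) (fst₁ g) (fst₁ f))
                                      (B.assoc (snd₁ h) (snd₁ g) (snd₁ f))
    }

  π₁ : Functor Pullback A
  π₁ = record { F₀ = fst ; F₁ = fst₁ ; F-id = refl ; F-∘ = λ _ _ → refl }

  π₂ : Functor Pullback B
  π₂ = record { F₀ = snd ; F₁ = snd₁ ; F-id = refl ; F-∘ = λ _ _ → refl }

  pair : {Z : Category o ℓ} (h : Functor Z A) (k : Functor Z B) →
         F ∘F h ≈F G ∘F k → Functor Z Pullback
  pair h k e = record
    { F₀   = λ X → ⟨ F₀ h X , F₀ k X ⟩[ _≈F_.eq₀ e X ]
    ; F₁   = λ f → ⟪ F₁ h f , F₁ k f ⟫[ _≈F_.eq₁ e f ]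
    ; F-id = PullbackHom-≡ (F-id h) (F-id k)
    ; F-∘  = λ g f → PullbackHom-≡ (F-∘ h g f) (F-∘ k g f)
    }

record PlainDTT (o ℓ : Level) : Set (lsuc (o ⊔ ℓ)) where
  field
    ctx          : Category o ℓ
    ∙            : Obj ctx
    ∙-terminal   : IsTerminal ctx ∙

    𝒰 𝒰̇          : Category o ℓ
    u            : Functor 𝒰 ctx
    u̇            : Functor 𝒰̇ ctx
    u-fibration  : IsFibration u
    u̇-fibration  : IsFibration u̇

    Σ            : Functor 𝒰̇ 𝒰
    Σ-over-ctx   : u ∘F Σ ≈F u̇
    Δ            : Functor 𝒰 𝒰̇
    Σ⊣Δ          : Adjunction Σ Δ

  open Adjunction Σ⊣Δ public using (η; ε)

  field
    η-cartesian  : ∀ a → IsCartesian u̇ (η a)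
    ε-cartesian  : ∀ A → IsCartesian u (ε A)
    Σ-cartesian  : PreservesCartesian u̇ u Σ
    Δ-cartesian  : PreservesCartesian u u̇ Δ

  -- For a category p : E → ctx over ctx, Γ ⊢ X ∈ p says that X is an object of
  -- E over Γ; thus Γ ⊢ A ∈ u says that A is a type over Γ.
  infix 4 _⊢_∈_ _⊢_∶_
  _⊢_∈_ : {E : Category o ℓ} → Obj ctx → Obj E → Functor E ctx → Set o
  Γ ⊢ X ∈ p = F₀ p X ≡ Γ

  _⊢_∶_ : Obj ctx → Obj 𝒰̇ → Obj 𝒰 → Set o
  Γ ⊢ a ∶ A = (Γ ⊢ a ∈ u̇) × (F₀ Σ a ≡ A)

  -- The categories and functors obtained from the generating data by finite
  -- limits in the category of categories. Any limiting cone is accepted, not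
  -- only a chosen one; terminal objects and pullbacks yield all finite limits.
  data IsJudgement : Category o ℓ → Set (lsuc (o ⊔ ℓ))
  data IsRule : {C D : Category o ℓ} → Functor C D → Set (lsuc (o ⊔ ℓ))

  data IsJudgement where
    gen-ctx  : IsJudgement ctx
    gen-𝒰    : IsJudgement 𝒰
    gen-𝒰̇    : IsJudgement 𝒰̇
    terminal : ∀ {T} → IsTerminalCategory T → IsJudgement T
    pullback : ∀ {P A B C} {F : Functor A C} {G : Functor B C}
               {p : Functor P A} {q : Functor P B} →
               IsRule F → IsRule G → IsPullback F G p q → IsJudgement P

  data IsRule where
    gen-u     : IsRule u
    gen-u̇     : IsRule u̇
    gen-Σ     : IsRule Σ
    gen-Δ     : IsRule Δ
    identity  : ∀ {C} → IsJudgement C → IsRule (idF {C = C})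
    composite : ∀ {C D E} {G : Functor D E} {F : Functor C D} →
                IsRule G → IsRule F → IsRule (G ∘F F)
    equal     : ∀ {C D} {F G : Functor C D} → F ≈F G → IsRule F → IsRule G
    to-terminal : ∀ {C T} → IsJudgement C → IsTerminalCategory T →
                  (F : Functor C T) → IsRule F
    project₁  : ∀ {P A B C} {F : Functor A C} {G : Functor B C}
                {p : Functor P A} {q : Functor P B} →
                IsRule F → IsRule G → IsPullback F G p q → IsRule p
    project₂  : ∀ {P A B C} {F : Functor A C} {G : Functor B C}
                {p : Functor P A} {q : Functor P B} →
                IsRule F → IsRule G → IsPullback F G p q → IsRule q
    mediating : ∀ {Z P A B C} {F : Functor A C} {G : Functor B C}
                {p : Functor P A} {q : Functor P B} →
                IsRule F → IsRule G → IsPullback F G p q →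
                (m : Functor Z P) → IsRule (p ∘F m) → IsRule (q ∘F m) → IsRule m

record ExtensionalTypes {o ℓ : Level} (T : PlainDTT o ℓ) : Set (lsuc (o ⊔ ℓ)) where
  open PlainDTT T
  field
    𝒳 𝒴         : Category o ℓ
    Λ           : Functor 𝒳 𝒴
    y           : Functor 𝒴 ctx
    𝒳-judgement : IsJudgement 𝒳
    𝒴-judgement : IsJudgement 𝒴
    Λ-rule      : IsRule Λ
    y-rule      : IsRule y

    Φ           : Functor 𝒴 𝒰
    Φ-over-ctx  : u ∘F Φ ≈F y
    Ψ           : Functor 𝒳 𝒰̇
    -- The field `commutes` is the equation Φ ∘ Λ = Σ ∘ Ψ.
    square      : IsPullback Φ Σ Λ Ψ

  x : Functor 𝒳 ctx
  x = y ∘F Λ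

  𝒴Σ·Φ𝒰̇ : Category o ℓ
  𝒴Σ·Φ𝒰̇ = Pullback Φ Σ

  𝒴Σ·Φ𝒰̇→ctx : Functor 𝒴Σ·Φ𝒰̇ ctx
  𝒴Σ·Φ𝒰̇→ctx = y ∘F π₁ Φ Σ

  Λ⋆Ψ : Functor 𝒳 𝒴Σ·Φ𝒰̇
  Λ⋆Ψ = pair Φ Σ Λ Ψ (IsPullback.commutes square)

{-# OPTIONS --safe #-}
-- A square of functors that is a pullback exhibits its corner as isomorphic to
-- the canonical pullback: the eliminator is the functor that the universal
-- property induces from the two canonical projections, and the two inverse laws
-- hold because both pairs of projections are jointly monic.
module Submission where

open import Defs
open import Data.Product using (_×_; ∃; _,_)
open import Relation.Binary.PropositionalEquality
  using (_≡_; refl; sym; trans; cong)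
open import Relation.Binary.PropositionalEquality.WithK using (≡-irrelevant)

open Category using (Obj; Hom; transport)
open _≈F_

≈F-trans : ∀ {o ℓ} {C D : Category o ℓ} {F G H : Functor C D} →
           F ≈F G → G ≈F H → F ≈F H
≈F-trans {D = D} {F} {G} {H} α β = record
  { eq₀ = λ A → trans (eq₀ α A) (eq₀ β A)
  ; eq₁ = λ f → transport-trans (eq₀ α _) (eq₀ β _) (eq₀ α _) (eq₀ β _) (eq₁ α f) (eq₁ β f)
  }
  where
  -- The endpoints are variables so that the paths can be matched with `refl`; the paths `eq₀ α A`
  -- run between values of functors and cannot be matched directly.
  transport-trans : ∀ {A A′ A″ B B′ B″} (p : A ≡ A′) (p′ : A′ ≡ A″) (q : B ≡ B′) (q′ : B′ ≡ B″)
                    {f : Hom D A B} {g : Hom D A′ B′} {h : Hom D A″ B″} →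
                    transport D p q f ≡ g → transport D p′ q′ g ≡ h →
                    transport D (trans p p′) (trans q q′) f ≡ h
  transport-trans refl refl refl refl refl refl = refl

≈F-sym : ∀ {o ℓ} {C D : Category o ℓ} {F G : Functor C D} → F ≈F G → G ≈F F
≈F-sym {D = D} α = record
  { eq₀ = λ A → sym (eq₀ α A)
  ; eq₁ = λ f → transport-sym (eq₀ α _) (eq₀ α _) (eq₁ α f)
  }
  where
  transport-sym : ∀ {A A′ B B′} (p : A ≡ A′) (q : B ≡ B′)
                  {f : Hom D A B} {g : Hom D A′ B′} →
                  transport D p q f ≡ g → transport D (sym p) (sym q) g ≡ f
  transport-sym refl refl refl = refl

∘F-congˡ : ∀ {o ℓ} {C D E : Category o ℓ} (G : Functor D E) {F F′ : Functor C D} →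
           F ≈F F′ → G ∘F F ≈F G ∘F F′
∘F-congˡ {D = D} {E} G α = record
  { eq₀ = λ A → cong (F₀ G) (eq₀ α A)
  ; eq₁ = λ f → transport-F₁ (eq₀ α _) (eq₀ α _) (eq₁ α f)
  }
  where
  transport-F₁ : ∀ {A A′ B B′} (p : A ≡ A′) (q : B ≡ B′)
                 {f : Hom D A B} {g : Hom D A′ B′} → transport D p q f ≡ g →
                 transport E (cong (F₀ G) p) (cong (F₀ G) q) (F₁ G f) ≡ F₁ G g
  transport-F₁ refl refl refl = refl

module _ {o ℓ} {A B C : Category o ℓ} (F : Functor A C) (G : Functor B C) where

  open PullbackObj
  open PullbackHom

  π-commutes : F ∘F π₁ F G ≈F G ∘F π₂ F G
  π-commutes = record { eq₀ = over ; eq₁ = over₁ }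

  PullbackObj-≡ : {X Y : PullbackObj F G} → fst X ≡ fst Y → snd X ≡ snd Y → X ≡ Y
  PullbackObj-≡ {⟨ _ , _ ⟩[ r ]} {⟨ _ , _ ⟩[ s ]} refl refl =
    cong ⟨ _ , _ ⟩[_] (≡-irrelevant r s)

  PullbackHom-≡ : {X Y : PullbackObj F G} {f g : PullbackHom F G X Y} →
                  fst₁ f ≡ fst₁ g → snd₁ f ≡ snd₁ g → f ≡ g
  PullbackHom-≡ {f = ⟪ _ , _ ⟫[ r ]} {⟪ _ , _ ⟫[ s ]} refl refl =
    cong ⟪ _ , _ ⟫[_] (≡-irrelevant r s)

  -- The paths in `A` and `B` are arbitrary rather than the images of `r` and `s` under `fst` and
  -- `snd`. By K the choice is immaterial, so equations obtained separately in each component can be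
  -- combined.
  transport-Pullback :
    {X X′ Y Y′ : PullbackObj F G} (r : X ≡ X′) (s : Y ≡ Y′)
    {f : PullbackHom F G X Y} {g : PullbackHom F G X′ Y′}
    (r₁ : fst X ≡ fst X′) (s₁ : fst Y ≡ fst Y′)
    (r₂ : snd X ≡ snd X′) (s₂ : snd Y ≡ snd Y′) →
    transport A r₁ s₁ (fst₁ f) ≡ fst₁ g → transport B r₂ s₂ (snd₁ f) ≡ snd₁ g →
    transport (Pullback F G) r s f ≡ g
  transport-Pullback refl refl refl refl refl refl = PullbackHom-≡

  -- Apart from their two components, objects and morphisms of the pullback carry only equations,
  -- and these are unique by K.
  π-jointly-monic : {Z : Category o ℓ} {H K : Functor Z (Pullback F G)} →
                    π₁ F G ∘F H ≈F π₁ F G ∘F K → π₂ F G ∘F H ≈F π₂ F G ∘F K → H ≈F K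
  π-jointly-monic α β = record
    { eq₀ = λ X → PullbackObj-≡ (eq₀ α X) (eq₀ β X)
    ; eq₁ = λ f → transport-Pullback _ _ (eq₀ α _) (eq₀ α _) (eq₀ β _) (eq₀ β _)
                                     (eq₁ α f) (eq₁ β f)
    }

  module _ {P : Category o ℓ} {p : Functor P A} {q : Functor P B}
           (pb : IsPullback F G p q) where
    open IsPullback pb

    fromPullback : Functor (Pullback F G) P
    fromPullback = mediate (π₁ F G) (π₂ F G) π-commutes

    toPullback : Functor P (Pullback F G)
    toPullback = pair F G p q commutes

    p∘fromPullback : p ∘F fromPullback ≈F π₁ F G
    p∘fromPullback = mediate₁ (π₁ F G) (π₂ F G) π-commutes

    q∘fromPullback : q ∘F fromPullback ≈F π₂ F G
    q∘fromPullback = mediate₂ (π₁ F G) (π₂ F G) π-commutes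

    -- The composites below agree with those in p∘fromPullback and q∘fromPullback
    -- only up to their F-id and F-∘ fields, hence the repackaged components.
    fromPullback∘toPullback : fromPullback ∘F toPullback ≈F idF
    fromPullback∘toPullback = ≈F-trans
      (unique p q commutes (fromPullback ∘F toPullback)
        (record { eq₀ = λ X → eq₀ p∘fromPullback (F₀ toPullback X)
                ; eq₁ = λ f → eq₁ p∘fromPullback (F₁ toPullback f) })
        (record { eq₀ = λ X → eq₀ q∘fromPullback (F₀ toPullback X)
                ; eq₁ = λ f → eq₁ q∘fromPullback (F₁ toPullback f) }))
      -- `idF` induces the same cone `p`, `q`, so it equals the same mediating functor as the
      -- composite does.
      (≈F-sym (unique p q commutes idF
        (record { eq₀ = λ _ → refl ; eq₁ = λ _ → refl })
        (record { eq₀ = λ _ → refl ; eq₁ = λ _ → refl })))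

    -- Followed by `π₁` and `π₂`, `toPullback` becomes `p` and `q`, which reduces the claim to the
    -- two equations defining `fromPullback`.
    toPullback∘fromPullback : toPullback ∘F fromPullback ≈F idF
    toPullback∘fromPullback = π-jointly-monic
      (record { eq₀ = eq₀ p∘fromPullback ; eq₁ = eq₁ p∘fromPullback })
      (record { eq₀ = eq₀ q∘fromPullback ; eq₁ = eq₁ q∘fromPullback })

mainTheorem8 :
  ∀ {o ℓ} (T : PlainDTT o ℓ) (P : ExtensionalTypes T) →
  let open PlainDTT T
      open ExtensionalTypes P
      open Category using (Obj)
  in
    -- (F)
    (∀ (Γ : Obj ctx) (Y : Obj 𝒴) → Γ ⊢ Y ∈ y → Γ ⊢ F₀ Φ Y ∈ u)
    -- (I)
  × (∀ (Γ : Obj ctx) (X : Obj 𝒳) → Γ ⊢ X ∈ x → Γ ⊢ F₀ Ψ X ∶ F₀ Φ (F₀ Λ X))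
    -- (E)
  × ∃ λ (E : Functor 𝒴Σ·Φ𝒰̇ 𝒳) →
      let _⟨_⟩[by_] : (Y : Obj 𝒴) (a : Obj 𝒰̇) → F₀ Φ Y ≡ F₀ Σ a → Obj 𝒳
          _⟨_⟩[by_] = λ Y a e → F₀ E ⟨ Y , a ⟩[ e ]
      in
        (x ∘F E ≈F 𝒴Σ·Φ𝒰̇→ctx)
      × (E ∘F Λ⋆Ψ ≈F idF)
      × (Λ⋆Ψ ∘F E ≈F idF)
        -- (β)
      × (∀ (X : Obj 𝒳) (e : F₀ Φ (F₀ Λ X) ≡ F₀ Σ (F₀ Ψ X)) →
           F₀ Ψ X ≡ F₀ Ψ (F₀ Λ X ⟨ F₀ Ψ X ⟩[by e ]))
        -- (η)
      × (∀ (Y : Obj 𝒴) (a : Obj 𝒰̇) (e : F₀ Φ Y ≡ F₀ Σ a) →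
           a ≡ F₀ Ψ (Y ⟨ a ⟩[by e ]))
mainTheorem8 T P =
    (λ Γ Y Y∈y → trans (eq₀ Φ-over-ctx Y) Y∈y)
  , (λ Γ X X∈x →
        -- A term lies over the context of its type, and the type of `Ψ X` is `Φ (Λ X)`, which lies
        -- over `y (Λ X)`.
        trans (sym (eq₀ Σ-over-ctx (F₀ Ψ X)))
          (trans (cong (F₀ u) (sym (eq₀ commutes X)))
            (trans (eq₀ Φ-over-ctx (F₀ Λ X)) X∈x))
      , sym (eq₀ commutes X))
  , fromPullback Φ Σ square
  -- `xE` brackets the composite as `y ∘F (Λ ∘F E)`; rebracketing changes only the functoriality
  -- proofs.
  , record { eq₀ = eq₀ xE ; eq₁ = eq₁ xE }
  , fromPullback∘toPullback Φ Σ square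
  , toPullback∘fromPullback Φ Σ square
  -- Both computation rules are the object part of `Ψ ∘F E ≈F π₂`, here taken at the pair `Λ X`,
  -- `Ψ X`.
  , (λ X e → sym (eq₀ (q∘fromPullback Φ Σ square) ⟨ F₀ Λ X , F₀ Ψ X ⟩[ e ]))
  , (λ Y a e → sym (eq₀ (q∘fromPullback Φ Σ square) ⟨ Y , a ⟩[ e ]))
  where
  open PlainDTT T
  open ExtensionalTypes P
  open IsPullback square using (commutes)
  xE = ∘F-congˡ y (p∘fromPullback Φ Σ square)
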